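{- Let $\ell:K(H\times\mathrm{Id})\to H\widehat K$ be an abstract GSOS rule with $\ell$-interpretation $b:KC\to C$, let $V$ be an endofunctor, $F=K+V$, $M=\widehat F$, and let $e:V(H\times\mathrm{Id})\to\widehat KHM$ be a natural transformation (a sandwiched $\ell$-rps). Then there is a unique $V$-algebra $s:VC\to C$ such that $$s=b^\sharp\cdot\widehat Kc^{ -1}\cdot\widehat KH[b,s]^\sharp\cdot e_C\cdot V\langle c,\mathrm{id}_C\rangle .$$ Moreover $[b,s]^\sharp\cdot Mc^{ -1}\cdot MH[b,s]^\sharp:MHMC\to C$ is a completely iterative algebra for $MHM$.
   Context: Let $\mathcal A$ be a category with binary products and coproducts, let $H:\mathcal A\to\mathcal A$ be a functor with a terminal coalgebra $c:C\to HC$ (an isomorphism by Lambek's lemma). For an endofunctor $G$ we assume free $G$-algebras exist for all objects, giving the free monad $\widehat G$ with unit $\eta$ and universal natural transformation $\kappa:G\to\widehat G$; for a $G$-algebra $a:GA\to A$, $a^\sharp:\widehat GA\to A$ is the unique $G$-algebra homomorphism with $a^\sharp\cdot\eta_A=\mathrm{id}_A$ (here $b^\sharp:\widehat KC\to C$ and $[b,s]^\sharp:\widehat FC\to C$). An abstract GSOS rule for $K$ is a natural transformation $\ell:K(H\times\mathrm{Id})\to H\widehat K$, its interpretation the unique $b:KC\to C$ with $c\cdot b=Hb^\sharp\cdot\ell_C\cdot K\langle c,\mathrm{id}_C\rangle$. A $G$-algebra $a:GA\to A$ is a completely iterative algebra if every $e:X\to GX+A$ has a unique $e^\dagger:X\to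 A$ with $e^\dagger=[a,\mathrm{id}_A]\cdot(Ge^\dagger+\mathrm{id}_A)\cdot e$.
   Formalization: Free algebras are assumed for K, for F = K+V and also for F+H; if the standing assumption on free algebras is read as covering only K and F, the claim fails in general (no solution s need exist). -}

module Defs where

open import Level using (Level; _⊔_; suc)
open import Data.Product using (∃!)
open import Relation.Binary using (Rel; IsEquivalence; Setoid)
import Relation.Binary.Reasoning.Setoid as SetoidReasoning

record Category (o h q : Level) : Set (suc (o ⊔ h ⊔ q)) where
  infix  4 _≈_ _⇒_
  infixr 9 _∘_
  field
    Obj : Set o
    _⇒_ : Obj → Obj → Set h
    _≈_ : ∀ {X Y} → Rel (X ⇒ Y) q
    id  : ∀ {X} → X ⇒ X
    _∘_ : ∀ {X Y Z} → Y ⇒ Z → X ⇒ Y → X ⇒ Z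
    isEquivalence : ∀ {X Y} → IsEquivalence (_≈_ {X} {Y})
    ∘-resp-≈  : ∀ {X Y Z} {f f′ : Y ⇒ Z} {g g′ : X ⇒ Y} → f ≈ f′ → g ≈ g′ → f ∘ g ≈ f′ ∘ g′
    identityˡ : ∀ {X Y} {f : X ⇒ Y} → id ∘ f ≈ f
    identityʳ : ∀ {X Y} {f : X ⇒ Y} → f ∘ id ≈ f
    assoc     : ∀ {W X Y Z} {f : W ⇒ X} {g : X ⇒ Y} {k : Y ⇒ Z} → (k ∘ g) ∘ f ≈ k ∘ (g ∘ f)

  homSetoid : Obj → Obj → Setoid h q
  homSetoid X Y = record { Carrier = X ⇒ Y ; _≈_ = _≈_ ; isEquivalence = isEquivalence }

  module Equiv {X Y : Obj} = IsEquivalence (isEquivalence {X} {Y})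
  module HomReasoning {X Y : Obj} = SetoidReasoning (homSetoid X Y)

  ∘-resp-≈ˡ : ∀ {X Y Z} {f f′ : Y ⇒ Z} {g : X ⇒ Y} → f ≈ f′ → f ∘ g ≈ f′ ∘ g
  ∘-resp-≈ˡ p = ∘-resp-≈ p Equiv.refl

  ∘-resp-≈ʳ : ∀ {X Y Z} {f : Y ⇒ Z} {g g′ : X ⇒ Y} → g ≈ g′ → f ∘ g ≈ f ∘ g′
  ∘-resp-≈ʳ p = ∘-resp-≈ Equiv.refl p

module _ {o h q : Level} (𝒜 : Category o h q) where
  open Category 𝒜

  record BinaryProducts : Set (o ⊔ h ⊔ q) where
    infixr 7 _×_
    field
      _×_   : Obj → Obj → Obj
      π₁    : ∀ {X Y} → X × Y ⇒ X
      π₂    : ∀ {X Y} → X × Y ⇒ Y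
      ⟨_,_⟩ : ∀ {X Y Z} → Z ⇒ X → Z ⇒ Y → Z ⇒ X × Y
      project₁ : ∀ {X Y Z} {f : Z ⇒ X} {g : Z ⇒ Y} → π₁ ∘ ⟨ f , g ⟩ ≈ f
      project₂ : ∀ {X Y Z} {f : Z ⇒ X} {g : Z ⇒ Y} → π₂ ∘ ⟨ f , g ⟩ ≈ g
      ⟨⟩-unique : ∀ {X Y Z} {f : Z ⇒ X} {g : Z ⇒ Y} {k : Z ⇒ X × Y} →
                  π₁ ∘ k ≈ f → π₂ ∘ k ≈ g → ⟨ f , g ⟩ ≈ k

    infixr 7 _×₁_
    _×₁_ : ∀ {X X′ Y Y′} → X ⇒ X′ → Y ⇒ Y′ → X × Y ⇒ X′ × Y′
    f ×₁ g = ⟨ f ∘ π₁ , g ∘ π₂ ⟩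

  record BinaryCoproducts : Set (o ⊔ h ⊔ q) where
    infixr 6 _+_
    field
      _+_   : Obj → Obj → Obj
      i₁    : ∀ {X Y} → X ⇒ X + Y
      i₂    : ∀ {X Y} → Y ⇒ X + Y
      [_,_] : ∀ {X Y Z} → X ⇒ Z → Y ⇒ Z → X + Y ⇒ Z
      inject₁ : ∀ {X Y Z} {f : X ⇒ Z} {g : Y ⇒ Z} → [ f , g ] ∘ i₁ ≈ f
      inject₂ : ∀ {X Y Z} {f : X ⇒ Z} {g : Y ⇒ Z} → [ f , g ] ∘ i₂ ≈ g
      []-unique : ∀ {X Y Z} {f : X ⇒ Z} {g : Y ⇒ Z} {k : X + Y ⇒ Z} →
                  k ∘ i₁ ≈ f → k ∘ i₂ ≈ g → [ f , g ] ≈ k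

    infixr 6 _+₁_
    _+₁_ : ∀ {X X′ Y Y′} → X ⇒ X′ → Y ⇒ Y′ → X + Y ⇒ X′ + Y′
    f +₁ g = [ i₁ ∘ f , i₂ ∘ g ]

  record Endofunctor : Set (o ⊔ h ⊔ q) where
    field
      F₀ : Obj → Obj
      F₁ : ∀ {X Y} → X ⇒ Y → F₀ X ⇒ F₀ Y
      F-resp-≈     : ∀ {X Y} {f g : X ⇒ Y} → f ≈ g → F₁ f ≈ F₁ g
      identity     : ∀ {X} → F₁ (id {X}) ≈ id
      homomorphism : ∀ {X Y Z} {f : X ⇒ Y} {g : Y ⇒ Z} → F₁ (g ∘ f) ≈ F₁ g ∘ F₁ f

module _ {o h q : Level} {𝒜 : Category o h q} where
  open Category 𝒜
  open Endofunctor

  Id : Endofunctor 𝒜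
  Id = record
    { F₀ = λ X → X
    ; F₁ = λ f → f
    ; F-resp-≈ = λ p → p
    ; identity = Equiv.refl
    ; homomorphism = Equiv.refl
    }

  infixr 9 _∘F_
  _∘F_ : Endofunctor 𝒜 → Endofunctor 𝒜 → Endofunctor 𝒜
  G ∘F F = record
    { F₀ = λ X → F₀ G (F₀ F X)
    ; F₁ = λ f → F₁ G (F₁ F f)
    ; F-resp-≈ = λ p → F-resp-≈ G (F-resp-≈ F p)
    ; identity = Equiv.trans (F-resp-≈ G (identity F)) (identity G)
    ; homomorphism = Equiv.trans (F-resp-≈ G (homomorphism F)) (homomorphism G)
    }

  record NaturalTransformation (F G : Endofunctor 𝒜) : Set (o ⊔ h ⊔ q) where
    field
      component : ∀ X → F₀ F X ⇒ F₀ G X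
      commute   : ∀ {X Y} (f : X ⇒ Y) → component Y ∘ F₁ F f ≈ F₁ G f ∘ component X

  module _ (products : BinaryProducts 𝒜) where
    open BinaryProducts products

    productFunctor : Endofunctor 𝒜 → Endofunctor 𝒜 → Endofunctor 𝒜
    productFunctor F G = record
      { F₀ = λ X → F₀ F X × F₀ G X
      ; F₁ = λ f → F₁ F f ×₁ F₁ G f
      ; F-resp-≈ = λ p → ⟨⟩-unique
          (Equiv.trans project₁ (∘-resp-≈ˡ (F-resp-≈ F (Equiv.sym p))))
          (Equiv.trans project₂ (∘-resp-≈ˡ (F-resp-≈ G (Equiv.sym p))))
      ; identity = ⟨⟩-unique
          (Equiv.trans identityʳ (Equiv.sym (Equiv.trans (∘-resp-≈ˡ (identity F)) identityˡ)))
          (Equiv.trans identityʳ (Equiv.sym (Equiv.trans (∘-resp-≈ˡ (identity G)) identityˡ)))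
      ; homomorphism = ⟨⟩-unique (hom F project₁ project₁) (hom G project₂ project₂)
      }
      where
      hom : ∀ (E : Endofunctor 𝒜) {X Y Z} {f : X ⇒ Y} {g : Y ⇒ Z} {P Q R : Obj}
              {p : P ⇒ F₀ E X} {p′ : Q ⇒ F₀ E Y} {p″ : R ⇒ F₀ E Z} {u : P ⇒ Q} {v : Q ⇒ R} →
            p″ ∘ v ≈ F₁ E g ∘ p′ → p′ ∘ u ≈ F₁ E f ∘ p →
            p″ ∘ (v ∘ u) ≈ F₁ E (g ∘ f) ∘ p
      hom E {f = f} {g} {p = p} {p′} {p″} {u} {v} eq₁ eq₂ = begin
        p″ ∘ (v ∘ u)             ≈⟨ assoc ⟨
        (p″ ∘ v) ∘ u             ≈⟨ ∘-resp-≈ˡ eq₁ ⟩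
        (F₁ E g ∘ p′) ∘ u        ≈⟨ assoc ⟩
        F₁ E g ∘ (p′ ∘ u)        ≈⟨ ∘-resp-≈ʳ eq₂ ⟩
        F₁ E g ∘ (F₁ E f ∘ p)    ≈⟨ assoc ⟨
        (F₁ E g ∘ F₁ E f) ∘ p    ≈⟨ ∘-resp-≈ˡ (homomorphism E) ⟨
        F₁ E (g ∘ f) ∘ p         ∎
        where open HomReasoning

  module _ (coproducts : BinaryCoproducts 𝒜) where
    open BinaryCoproducts coproducts

    coproductFunctor : Endofunctor 𝒜 → Endofunctor 𝒜 → Endofunctor 𝒜
    coproductFunctor F G = record
      { F₀ = λ X → F₀ F X + F₀ G X
      ; F₁ = λ f → F₁ F f +₁ F₁ G f
      ; F-resp-≈ = λ p → []-unique
          (Equiv.trans inject₁ (∘-resp-≈ʳ (F-resp-≈ F (Equiv.sym p))))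
          (Equiv.trans inject₂ (∘-resp-≈ʳ (F-resp-≈ G (Equiv.sym p))))
      ; identity = []-unique
          (Equiv.trans identityˡ (Equiv.sym (Equiv.trans (∘-resp-≈ʳ (identity F)) identityʳ)))
          (Equiv.trans identityˡ (Equiv.sym (Equiv.trans (∘-resp-≈ʳ (identity G)) identityʳ)))
      ; homomorphism = []-unique (hom F inject₁ inject₁) (hom G inject₂ inject₂)
      }
      where
      hom : ∀ (E : Endofunctor 𝒜) {X Y Z} {f : X ⇒ Y} {g : Y ⇒ Z} {P Q R : Obj}
              {i : F₀ E X ⇒ P} {i′ : F₀ E Y ⇒ Q} {i″ : F₀ E Z ⇒ R} {u : P ⇒ Q} {v : Q ⇒ R} →
            v ∘ i′ ≈ i″ ∘ F₁ E g → u ∘ i ≈ i′ ∘ F₁ E f →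
            (v ∘ u) ∘ i ≈ i″ ∘ F₁ E (g ∘ f)
      hom E {f = f} {g} {i = i} {i′} {i″} {u} {v} eq₁ eq₂ = begin
        (v ∘ u) ∘ i              ≈⟨ assoc ⟩
        v ∘ (u ∘ i)              ≈⟨ ∘-resp-≈ʳ eq₂ ⟩
        v ∘ (i′ ∘ F₁ E f)        ≈⟨ assoc ⟨
        (v ∘ i′) ∘ F₁ E f        ≈⟨ ∘-resp-≈ˡ eq₁ ⟩
        (i″ ∘ F₁ E g) ∘ F₁ E f   ≈⟨ assoc ⟩
        i″ ∘ (F₁ E g ∘ F₁ E f)   ≈⟨ ∘-resp-≈ʳ (homomorphism E) ⟨
        i″ ∘ F₁ E (g ∘ f)        ∎
        where open HomReasoning

    IsCompletelyIterative : (G : Endofunctor 𝒜) {A : Obj} → F₀ G A ⇒ A → Set (o ⊔ h ⊔ q)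
    IsCompletelyIterative G {A} a =
      ∀ {X} (e : X ⇒ F₀ G X + A) →
      ∃! _≈_ λ (e† : X ⇒ A) → e† ≈ [ a , id ] ∘ (F₁ G e† +₁ id) ∘ e

  IsAlgebraHom : (G : Endofunctor 𝒜) {A B : Obj} → F₀ G A ⇒ A → F₀ G B ⇒ B → A ⇒ B → Set q
  IsAlgebraHom G a b f = f ∘ a ≈ b ∘ F₁ G f

  IsCoalgebraHom : (G : Endofunctor 𝒜) {A B : Obj} → A ⇒ F₀ G A → B ⇒ F₀ G B → A ⇒ B → Set q
  IsCoalgebraHom G a b f = b ∘ f ≈ F₁ G f ∘ a

  record FreeAlgebra (G : Endofunctor 𝒜) (X : Obj) : Set (o ⊔ h ⊔ q) where
    field
      carrier   : Obj
      structure : F₀ G carrier ⇒ carrier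
      unit      : X ⇒ carrier
      extend        : ∀ {A} (a : F₀ G A ⇒ A) (f : X ⇒ A) → carrier ⇒ A
      extend-hom    : ∀ {A} {a : F₀ G A ⇒ A} {f : X ⇒ A} → IsAlgebraHom G structure a (extend a f)
      extend-unit   : ∀ {A} {a : F₀ G A ⇒ A} {f : X ⇒ A} → extend a f ∘ unit ≈ f
      extend-unique : ∀ {A} {a : F₀ G A ⇒ A} {f : X ⇒ A} {k : carrier ⇒ A} →
                      IsAlgebraHom G structure a k → k ∘ unit ≈ f → extend a f ≈ k

  FreeAlgebras : Endofunctor 𝒜 → Set (o ⊔ h ⊔ q)
  FreeAlgebras G = ∀ X → FreeAlgebra G X

  module FreeMonad {G : Endofunctor 𝒜} (free : FreeAlgebras G) where
    private module Free X = FreeAlgebra (free X)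
    open Free using (carrier; structure)

    η : ∀ X → X ⇒ carrier X
    η = Free.unit

    functor : Endofunctor 𝒜
    functor = record
      { F₀ = carrier
      ; F₁ = λ {X} {Y} → map X Y
      ; F-resp-≈ = λ {X} {Y} p → Free.extend-unique X (Free.extend-hom X)
          (Equiv.trans (Free.extend-unit X) (∘-resp-≈ʳ (Equiv.sym p)))
      ; identity = λ {X} → Free.extend-unique X
          (Equiv.trans identityˡ (Equiv.sym (Equiv.trans (∘-resp-≈ʳ (identity G)) identityʳ)))
          (Equiv.trans identityˡ (Equiv.sym identityʳ))
      ; homomorphism = λ {X} {Y} {Z} {f} {g} → Free.extend-unique X
          (begin
            (map Y Z g ∘ map X Y f) ∘ structure X               ≈⟨ assoc ⟩
            map Y Z g ∘ (map X Y f ∘ structure X)               ≈⟨ ∘-resp-≈ʳ (Free.extend-hom X) ⟩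
            map Y Z g ∘ (structure Y ∘ F₁ G (map X Y f))        ≈⟨ assoc ⟨
            (map Y Z g ∘ structure Y) ∘ F₁ G (map X Y f)        ≈⟨ ∘-resp-≈ˡ (Free.extend-hom Y) ⟩
            (structure Z ∘ F₁ G (map Y Z g)) ∘ F₁ G (map X Y f) ≈⟨ assoc ⟩
            structure Z ∘ (F₁ G (map Y Z g) ∘ F₁ G (map X Y f)) ≈⟨ ∘-resp-≈ʳ (homomorphism G) ⟨
            structure Z ∘ F₁ G (map Y Z g ∘ map X Y f)          ∎)
          (begin
            (map Y Z g ∘ map X Y f) ∘ η X   ≈⟨ assoc ⟩
            map Y Z g ∘ (map X Y f ∘ η X)   ≈⟨ ∘-resp-≈ʳ (Free.extend-unit X) ⟩
            map Y Z g ∘ (η Y ∘ f)           ≈⟨ assoc ⟨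
            (map Y Z g ∘ η Y) ∘ f           ≈⟨ ∘-resp-≈ˡ (Free.extend-unit Y) ⟩
            (η Z ∘ g) ∘ f                   ≈⟨ assoc ⟩
            η Z ∘ (g ∘ f)                   ∎)
      }
      where
      open HomReasoning
      map : ∀ X Y → X ⇒ Y → carrier X ⇒ carrier Y
      map X Y f = Free.extend X (structure Y) (η Y ∘ f)

    infix 10 _♯
    _♯ : ∀ {A} → F₀ G A ⇒ A → carrier A ⇒ A
    _♯ {A} a = Free.extend A a id

  record TerminalCoalgebra (H : Endofunctor 𝒜) : Set (o ⊔ h ⊔ q) where
    field
      C : Obj
      c : C ⇒ F₀ H C
      unfold        : ∀ {A} (a : A ⇒ F₀ H A) → A ⇒ C
      unfold-hom    : ∀ {A} {a : A ⇒ F₀ H A} → IsCoalgebraHom H a c (unfold a)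
      unfold-unique : ∀ {A} {a : A ⇒ F₀ H A} {k : A ⇒ C} → IsCoalgebraHom H a c k → unfold a ≈ k

    c⁻¹ : F₀ H C ⇒ C
    c⁻¹ = unfold (F₁ H c)

    c⁻¹∘c≈id : c⁻¹ ∘ c ≈ id
    c⁻¹∘c≈id = Equiv.trans
      (Equiv.sym (unfold-unique (begin
        c ∘ (c⁻¹ ∘ c)               ≈⟨ assoc ⟨
        (c ∘ c⁻¹) ∘ c               ≈⟨ ∘-resp-≈ˡ unfold-hom ⟩
        (F₁ H c⁻¹ ∘ F₁ H c) ∘ c     ≈⟨ ∘-resp-≈ˡ (homomorphism H) ⟨
        F₁ H (c⁻¹ ∘ c) ∘ c          ∎)))
      (unfold-unique (Equiv.trans identityʳ
        (Equiv.sym (Equiv.trans (∘-resp-≈ˡ (identity H)) identityˡ))))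
      where open HomReasoning

    c∘c⁻¹≈id : c ∘ c⁻¹ ≈ id
    c∘c⁻¹≈id = begin
      c ∘ c⁻¹               ≈⟨ unfold-hom ⟩
      F₁ H c⁻¹ ∘ F₁ H c     ≈⟨ homomorphism H ⟨
      F₁ H (c⁻¹ ∘ c)        ≈⟨ F-resp-≈ H c⁻¹∘c≈id ⟩
      F₁ H id               ≈⟨ identity H ⟩
      id                    ∎
      where open HomReasoning

module GSOS
  {o h q : Level} {𝒜 : Category o h q}
  (products : BinaryProducts 𝒜) {H : Endofunctor 𝒜} (terminal : TerminalCoalgebra H)
  {K : Endofunctor 𝒜} (freeK : FreeAlgebras K)
  where
  open Category 𝒜
  open BinaryProducts products
  open TerminalCoalgebra terminal
  open FreeMonad freeK using (_♯) renaming (functor to K̂)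
  private
    module H = Endofunctor H
    module K = Endofunctor K

  H×Id : Endofunctor 𝒜
  H×Id = productFunctor products H Id

  AbstractGSOSRule : Set (o ⊔ h ⊔ q)
  AbstractGSOSRule = NaturalTransformation (K ∘F H×Id) (H ∘F K̂)

  -- Every abstract GSOS rule has exactly one b satisfying this equation.
  IsInterpretation : AbstractGSOSRule → (K.F₀ C ⇒ C) → Set q
  IsInterpretation ℓ b = c ∘ b ≈ H.F₁ (b ♯) ∘ component C ∘ K.F₁ ⟨ c , id ⟩
    where open NaturalTransformation ℓ

module Sandwiched
  {o h q : Level} {𝒜 : Category o h q}
  (products : BinaryProducts 𝒜) (coproducts : BinaryCoproducts 𝒜)
  {H : Endofunctor 𝒜} (terminal : TerminalCoalgebra H)
  {K : Endofunctor 𝒜} (freeK : FreeAlgebras K)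
  (V : Endofunctor 𝒜) (freeF : FreeAlgebras (coproductFunctor coproducts K V))
  where
  open Category 𝒜
  open BinaryProducts products
  open BinaryCoproducts coproducts
  open TerminalCoalgebra terminal
  open GSOS products terminal freeK using (H×Id)
  open FreeMonad freeK using () renaming (functor to K̂; _♯ to _♯ᴷ)
  open FreeMonad freeF using () renaming (functor to M; _♯ to _♯ᶠ)
  private
    module H = Endofunctor H
    module K = Endofunctor K
    module V = Endofunctor V
    module K̂ = Endofunctor K̂
    module M = Endofunctor M

  SandwichedRPS : Set (o ⊔ h ⊔ q)
  SandwichedRPS = NaturalTransformation (V ∘F H×Id) (K̂ ∘F H ∘F M)

  IsSolution : (K.F₀ C ⇒ C) → SandwichedRPS → (V.F₀ C ⇒ C) → Set q
  IsSolution b e s =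
    s ≈ b ♯ᴷ ∘ K̂.F₁ c⁻¹ ∘ K̂.F₁ (H.F₁ ([ b , s ] ♯ᶠ)) ∘ component C ∘ V.F₁ ⟨ c , id ⟩
    where open NaturalTransformation e

  MHM : Endofunctor 𝒜
  MHM = M ∘F H ∘F M

  MHM-algebra : (K.F₀ C ⇒ C) → (V.F₀ C ⇒ C) → MHM .Endofunctor.F₀ C ⇒ C
  MHM-algebra b s = [ b , s ] ♯ᶠ ∘ M.F₁ c⁻¹ ∘ M.F₁ (H.F₁ ([ b , s ] ♯ᶠ))

{-# OPTIONS --safe #-}

-- The target K̂HM of a sandwiched rps has no M-component beside its HM-component, so
-- ℓ cannot be applied to it directly. Adjoining H itself as an operation, to be
-- interpreted by c⁻¹, repairs this: an element of HMX is both a one-step behaviour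
-- and a term of N = free monad on G = (K + V) + H, so HMX maps to HNX × NX, and
-- iterating ℓ sends K̂HMX to HNX. Hence ℓ and e combine into one abstract GSOS rule
-- for G, whose interpretations are exactly [[b,s],c⁻¹] with s a solution of e.
-- An abstract GSOS rule has a unique interpretation a, and every z : Z → HNZ has a
-- unique u with c·u = H(a♯·Nu)·z. The same flattening turns an equation X → MHMX + C
-- into such a z on Z = X + C, where c forces u to be the identity on parameters.
module Submission where

open import Level using (Level)
open import Data.Product using (∃!; _×_; _,_; proj₁; proj₂)
open import Defs

-- Equational tools for categories, functors, products, coproducts and free algebras.

module _ {o h q : Level} (𝒜 : Category o h q) where
  open Category 𝒜
  open Equiv
  open HomReasoning

  module CategoryLemmas where
    pullˡ : ∀ {W X Y Z} {f : Y ⇒ Z} {g : X ⇒ Y} {k : W ⇒ X} {l : X ⇒ Z} →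
            f ∘ g ≈ l → f ∘ (g ∘ k) ≈ l ∘ k
    pullˡ p = trans (sym assoc) (∘-resp-≈ˡ p)

    pullʳ : ∀ {W X Y Z} {f : Y ⇒ Z} {g : X ⇒ Y} {k : W ⇒ X} {l : W ⇒ Y} →
            g ∘ k ≈ l → (f ∘ g) ∘ k ≈ f ∘ l
    pullʳ p = trans assoc (∘-resp-≈ʳ p)

    swapˡ : ∀ {W X Y Y′ Z} {f : Y ⇒ Z} {g : X ⇒ Y} {f′ : Y′ ⇒ Z} {g′ : X ⇒ Y′} {k : W ⇒ X} →
            f ∘ g ≈ f′ ∘ g′ → f ∘ (g ∘ k) ≈ f′ ∘ (g′ ∘ k)
    swapˡ p = trans (pullˡ p) assoc

    cancelˡ : ∀ {X Y Z} {f : Y ⇒ X} {g : X ⇒ Y} {k : Z ⇒ X} → f ∘ g ≈ id → f ∘ (g ∘ k) ≈ k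
    cancelˡ p = trans (pullˡ p) identityˡ

  module FunctorLemmas (F : Endofunctor 𝒜) where
    open Endofunctor F

    F-∘ : ∀ {X Y Z} {f : Y ⇒ Z} {g : X ⇒ Y} {k : X ⇒ Z} → f ∘ g ≈ k → F₁ f ∘ F₁ g ≈ F₁ k
    F-∘ p = trans (sym homomorphism) (F-resp-≈ p)

    F-id : ∀ {X} {f : X ⇒ X} → f ≈ id → F₁ f ≈ id
    F-id p = trans (F-resp-≈ p) identity

    F-square : ∀ {W X Y Z} {f : Y ⇒ Z} {g : X ⇒ Y} {f′ : W ⇒ Z} {g′ : X ⇒ W} →
               f ∘ g ≈ f′ ∘ g′ → F₁ f ∘ F₁ g ≈ F₁ f′ ∘ F₁ g′
    F-square p = trans (F-∘ p) homomorphism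

    hom-∘ : ∀ {X Y Z} {x : F₀ X ⇒ X} {y : F₀ Y ⇒ Y} {z : F₀ Z ⇒ Z} {f : X ⇒ Y} {g : Y ⇒ Z} →
            IsAlgebraHom F y z g → IsAlgebraHom F x y f → IsAlgebraHom F x z (g ∘ f)
    hom-∘ {x = x} {y} {z} {f} {g} p r = begin
      (g ∘ f) ∘ x             ≈⟨ pullʳ r ⟩
      g ∘ (y ∘ F₁ f)          ≈⟨ swapˡ p ⟩
      z ∘ (F₁ g ∘ F₁ f)       ≈⟨ ∘-resp-≈ʳ homomorphism ⟨
      z ∘ F₁ (g ∘ f)          ∎
      where open CategoryLemmas

    cohom-∘ : ∀ {X Y Z} {x : X ⇒ F₀ X} {y : Y ⇒ F₀ Y} {z : Z ⇒ F₀ Z} {f : X ⇒ Y} {g : Y ⇒ Z} →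
              IsCoalgebraHom F y z g → IsCoalgebraHom F x y f → IsCoalgebraHom F x z (g ∘ f)
    cohom-∘ {x = x} {y} {z} {f} {g} p r = begin
      z ∘ (g ∘ f)             ≈⟨ swapˡ p ⟩
      F₁ g ∘ (y ∘ f)          ≈⟨ ∘-resp-≈ʳ r ⟩
      F₁ g ∘ (F₁ f ∘ x)       ≈⟨ pullˡ (sym homomorphism) ⟩
      F₁ (g ∘ f) ∘ x          ∎
      where open CategoryLemmas

  module ProductLemmas (products : BinaryProducts 𝒜) where
    open BinaryProducts products hiding (_×_)
    open CategoryLemmas

    ⟨⟩-cong : ∀ {X Y Z} {f f′ : Z ⇒ X} {g g′ : Z ⇒ Y} → f ≈ f′ → g ≈ g′ → ⟨ f , g ⟩ ≈ ⟨ f′ , g′ ⟩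
    ⟨⟩-cong p r = ⟨⟩-unique (trans project₁ (sym p)) (trans project₂ (sym r))

    ⟨⟩-∘ : ∀ {W X Y Z} {f : Z ⇒ X} {g : Z ⇒ Y} {k : W ⇒ Z} → ⟨ f , g ⟩ ∘ k ≈ ⟨ f ∘ k , g ∘ k ⟩
    ⟨⟩-∘ = sym (⟨⟩-unique (pullˡ project₁) (pullˡ project₂))

    ×₁-⟨⟩ : ∀ {X X′ Y Y′ Z} {f : Z ⇒ X} {g : Z ⇒ Y} {p : X ⇒ X′} {r : Y ⇒ Y′} →
            (p ×₁ r) ∘ ⟨ f , g ⟩ ≈ ⟨ p ∘ f , r ∘ g ⟩
    ×₁-⟨⟩ = trans ⟨⟩-∘ (⟨⟩-cong (pullʳ project₁) (pullʳ project₂))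

  module CoproductLemmas (coproducts : BinaryCoproducts 𝒜) where
    open BinaryCoproducts coproducts
    open CategoryLemmas

    []-ext : ∀ {X Y Z} {f g : X + Y ⇒ Z} → f ∘ i₁ ≈ g ∘ i₁ → f ∘ i₂ ≈ g ∘ i₂ → f ≈ g
    []-ext p r = trans (sym ([]-unique p r)) ([]-unique refl refl)

    []-cong : ∀ {X Y Z} {f f′ : X ⇒ Z} {g g′ : Y ⇒ Z} → f ≈ f′ → g ≈ g′ → [ f , g ] ≈ [ f′ , g′ ]
    []-cong p r = []-unique (trans inject₁ (sym p)) (trans inject₂ (sym r))

    ∘-[] : ∀ {W X Y Z} {f : X ⇒ Z} {g : Y ⇒ Z} {k : Z ⇒ W} → k ∘ [ f , g ] ≈ [ k ∘ f , k ∘ g ]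
    ∘-[] = sym ([]-unique (pullʳ inject₁) (pullʳ inject₂))

    []-+₁ : ∀ {X X′ Y Y′ Z} {f : X′ ⇒ Z} {g : Y′ ⇒ Z} {p : X ⇒ X′} {r : Y ⇒ Y′} →
            [ f , g ] ∘ (p +₁ r) ≈ [ f ∘ p , g ∘ r ]
    []-+₁ = trans ∘-[] ([]-cong (pullˡ inject₁) (pullˡ inject₂))

  module FreeAlgebraLemmas {G : Endofunctor 𝒜} (free : FreeAlgebras G) where
    open CategoryLemmas
    open FunctorLemmas G
    open FreeMonad free
    open module Free {X} = FreeAlgebra (free X) public
      using (structure; extend; extend-hom; extend-unit; extend-unique)
    private
      module G = Endofunctor G
      module Ĝ = Endofunctor functor

    extend-cong : ∀ {X A} {a a′ : G.F₀ A ⇒ A} {f f′ : X ⇒ A} → a ≈ a′ → f ≈ f′ → extend a f ≈ extend a′ f′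
    extend-cong p r =
      extend-unique (trans extend-hom (∘-resp-≈ˡ (sym p))) (trans extend-unit (sym r))

    extend-fusion : ∀ {X A B} {a : G.F₀ A ⇒ A} {b : G.F₀ B ⇒ B} {f : X ⇒ A} {g : X ⇒ B} {p : A ⇒ B} →
                    IsAlgebraHom G a b p → p ∘ f ≈ g → p ∘ extend a f ≈ extend b g
    extend-fusion p r = sym (extend-unique (hom-∘ p extend-hom) (trans (pullʳ extend-unit) r))

    extend-map : ∀ {X Y A} {a : G.F₀ A ⇒ A} {f : Y ⇒ A} {g : X ⇒ Y} →
                 extend a f ∘ Ĝ.F₁ g ≈ extend a (f ∘ g)
    extend-map = extend-fusion extend-hom (pullˡ extend-unit)

    ♯-map : ∀ {X A} {a : G.F₀ A ⇒ A} {g : X ⇒ A} → a ♯ ∘ Ĝ.F₁ g ≈ extend a g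
    ♯-map = trans extend-map (extend-cong refl identityˡ)

    ♯-hom : ∀ {A B} {a : G.F₀ A ⇒ A} {b : G.F₀ B ⇒ B} {f : A ⇒ B} → IsAlgebraHom G a b f →
            f ∘ a ♯ ≈ b ♯ ∘ Ĝ.F₁ f
    ♯-hom p = trans (extend-fusion p identityʳ) (sym ♯-map)

-- Abstract GSOS rules: unique interpretation and corecursion.

module _
  {o h q : Level} {𝒜 : Category o h q}
  (products : BinaryProducts 𝒜) {H : Endofunctor 𝒜} (terminal : TerminalCoalgebra H)
  {G : Endofunctor 𝒜} (freeG : FreeAlgebras G)
  where
  open Category 𝒜
  open Equiv
  open HomReasoning
  open BinaryProducts products hiding (_×_)
  open TerminalCoalgebra terminal
  open GSOS products terminal freeG
  open FreeMonad freeG using (η; _♯) renaming (functor to Ĝ)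
  open CategoryLemmas 𝒜
  open ProductLemmas 𝒜 products
  open FreeAlgebraLemmas 𝒜 freeG
  private
    module H = Endofunctor H
    module G = Endofunctor G
    module Ĝ = Endofunctor Ĝ
    module HL = FunctorLemmas 𝒜 H
    module GL = FunctorLemmas 𝒜 G
    module H×Id = Endofunctor H×Id

  module GSOSLemmas (ρ : AbstractGSOSRule) where
    open NaturalTransformation ρ renaming (component to ρ₀; commute to ρ-commute)

    -- The lifting of the functor `H × Id` from objects to G-algebras. The second factor keeps the
    -- term itself, since a GSOS rule consults the arguments as well as their behaviour.
    ruleAlgebra : ∀ {A} → G.F₀ A ⇒ A → G.F₀ (H×Id.F₀ A) ⇒ H×Id.F₀ A
    ruleAlgebra {A} a = ⟨ H.F₁ (a ♯) ∘ ρ₀ A , a ∘ G.F₁ π₂ ⟩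

    ruleAlgebra-cong : ∀ {A} {a a′ : G.F₀ A ⇒ A} → a ≈ a′ → ruleAlgebra a ≈ ruleAlgebra a′
    ruleAlgebra-cong p = ⟨⟩-cong (∘-resp-≈ˡ (H.F-resp-≈ (extend-cong p refl))) (∘-resp-≈ˡ p)

    ruleAlgebra-hom : ∀ {A B} {a : G.F₀ A ⇒ A} {b : G.F₀ B ⇒ B} {f : A ⇒ B} → IsAlgebraHom G a b f →
                      IsAlgebraHom G (ruleAlgebra a) (ruleAlgebra b) (H×Id.F₁ f)
    ruleAlgebra-hom {A} {B} {a} {b} {f} p = begin
      H×Id.F₁ f ∘ ruleAlgebra a
        ≈⟨ ×₁-⟨⟩ ⟩
      ⟨ H.F₁ f ∘ (H.F₁ (a ♯) ∘ ρ₀ A) , f ∘ (a ∘ G.F₁ π₂) ⟩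
        ≈⟨ ⟨⟩-cong
             (trans (swapˡ (HL.F-square (♯-hom p))) (trans (∘-resp-≈ʳ (sym (ρ-commute f))) (sym assoc)))
             (trans (swapˡ p) (trans (∘-resp-≈ʳ (GL.F-square (sym project₂))) (sym assoc))) ⟩
      ⟨ (H.F₁ (b ♯) ∘ ρ₀ B) ∘ G.F₁ (H×Id.F₁ f) , (b ∘ G.F₁ π₂) ∘ G.F₁ (H×Id.F₁ f) ⟩
        ≈⟨ ⟨⟩-∘ ⟨
      ruleAlgebra b ∘ G.F₁ (H×Id.F₁ f) ∎

    -- The bialgebra condition for `ρ` on an arbitrary carrier; at `x = c` it is definitionally
    -- `IsInterpretation ρ a`.
    IsModel : ∀ {A} → G.F₀ A ⇒ A → A ⇒ H.F₀ A → Set q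
    IsModel {A} a x = x ∘ a ≈ H.F₁ (a ♯) ∘ ρ₀ A ∘ G.F₁ ⟨ x , id ⟩

    -- Recasts the model condition as a homomorphism property, so that freeness of Ĝ applies to
    -- `⟨ x , id ⟩`; the second component holds automatically.
    model-hom : ∀ {A} {a : G.F₀ A ⇒ A} {x : A ⇒ H.F₀ A} → IsModel a x →
                IsAlgebraHom G a (ruleAlgebra a) ⟨ x , id ⟩
    model-hom {A} {a} {x} p = begin
      ⟨ x , id ⟩ ∘ a
        ≈⟨ ⟨⟩-∘ ⟩
      ⟨ x ∘ a , id ∘ a ⟩
        ≈⟨ ⟨⟩-cong (trans p (sym assoc))
             (trans identityˡ (sym (trans (pullʳ (trans (GL.F-∘ project₂) G.identity)) identityʳ))) ⟩
      ⟨ (H.F₁ (a ♯) ∘ ρ₀ A) ∘ G.F₁ ⟨ x , id ⟩ , (a ∘ G.F₁ π₂) ∘ G.F₁ ⟨ x , id ⟩ ⟩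
        ≈⟨ ⟨⟩-∘ ⟨
      ruleAlgebra a ∘ G.F₁ ⟨ x , id ⟩ ∎

    private
      lift×id : ∀ {Z} → Z ⇒ H.F₀ (Ĝ.F₀ Z) → Ĝ.F₀ Z ⇒ H×Id.F₀ (Ĝ.F₀ Z)
      lift×id z = extend (ruleAlgebra structure) ⟨ z , η _ ⟩

    lift : ∀ {Z} → Z ⇒ H.F₀ (Ĝ.F₀ Z) → Ĝ.F₀ Z ⇒ H.F₀ (Ĝ.F₀ Z)
    lift z = π₁ ∘ lift×id z

    private
      -- `π₂` is a homomorphism back to the free algebra, so the second component of `lift×id z` is
      -- an endomorphism fixing the generators, hence the identity.
      lift×id-split : ∀ {Z} {z : Z ⇒ H.F₀ (Ĝ.F₀ Z)} → ⟨ lift z , id ⟩ ≈ lift×id z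
      lift×id-split = ⟨⟩-unique refl
        (trans (extend-fusion project₂ project₂)
          (extend-unique (trans identityˡ (sym (trans (∘-resp-≈ʳ G.identity) identityʳ))) identityˡ))

    lift-unit : ∀ {Z} {z : Z ⇒ H.F₀ (Ĝ.F₀ Z)} → lift z ∘ η Z ≈ z
    lift-unit = trans (pullʳ extend-unit) project₁

    lift-model : ∀ {Z} {z : Z ⇒ H.F₀ (Ĝ.F₀ Z)} → IsModel structure (lift z)
    lift-model {Z} {z} = begin
      (π₁ ∘ lift×id z) ∘ structure
        ≈⟨ pullʳ extend-hom ⟩
      π₁ ∘ (ruleAlgebra structure ∘ G.F₁ (lift×id z))
        ≈⟨ pullˡ project₁ ⟩
      (H.F₁ (structure ♯) ∘ ρ₀ _) ∘ G.F₁ (lift×id z)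
        ≈⟨ assoc ⟩
      H.F₁ (structure ♯) ∘ ρ₀ _ ∘ G.F₁ (lift×id z)
        ≈⟨ ∘-resp-≈ʳ (∘-resp-≈ʳ (G.F-resp-≈ lift×id-split)) ⟨
      H.F₁ (structure ♯) ∘ ρ₀ _ ∘ G.F₁ ⟨ lift z , id ⟩ ∎

    -- `⟨ x , id ⟩ ∘ extend a u` and `H×Id.F₁ w ∘ lift×id z` are homomorphisms from the free algebra
    -- to `ruleAlgebra a` that agree on generators; the first projection gives the claim.
    extend-lift : ∀ {A Z} {a : G.F₀ A ⇒ A} {x : A ⇒ H.F₀ A} {z : Z ⇒ H.F₀ (Ĝ.F₀ Z)} {u : Z ⇒ A} →
                  IsModel a x → x ∘ u ≈ H.F₁ (extend a u) ∘ z →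
                  IsCoalgebraHom H (lift z) x (extend a u)
    extend-lift {A} {Z} {a} {x} {z} {u} model p = begin
      x ∘ extend a u                                ≈⟨ pullˡ project₁ ⟨
      π₁ ∘ (⟨ x , id ⟩ ∘ extend a u)                ≈⟨ ∘-resp-≈ʳ (extend-fusion (model-hom model) atUnit) ⟩
      π₁ ∘ extend (ruleAlgebra a) ⟨ H.F₁ w ∘ z , w ∘ η Z ⟩
                                                    ≈⟨ ∘-resp-≈ʳ (extend-fusion (ruleAlgebra-hom extend-hom) ×₁-⟨⟩) ⟨
      π₁ ∘ (H×Id.F₁ w ∘ lift×id z)                  ≈⟨ swapˡ project₁ ⟩
      H.F₁ w ∘ lift z                               ∎
      where
      w = extend a u
      atUnit : ⟨ x , id ⟩ ∘ u ≈ ⟨ H.F₁ w ∘ z , w ∘ η Z ⟩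
      atUnit = trans ⟨⟩-∘ (⟨⟩-cong p (trans identityˡ (sym extend-unit)))

    private
      extend-lift-coalgebra : ∀ {A X} {a : G.F₀ A ⇒ A} {x : A ⇒ H.F₀ A} {y : X ⇒ H.F₀ X} {u : X ⇒ A} →
                              IsModel a x → IsCoalgebraHom H y x u →
                              IsCoalgebraHom H (lift (H.F₁ (η X) ∘ y)) x (extend a u)
      extend-lift-coalgebra model p =
        extend-lift model (trans p (sym (pullˡ (HL.F-∘ extend-unit))))

      id-cohom : ∀ {X} {x : X ⇒ H.F₀ X} → IsCoalgebraHom H x x id
      id-cohom = trans identityʳ (sym (trans (∘-resp-≈ˡ H.identity) identityˡ))

    unfold-ext : ∀ {X} {x : X ⇒ H.F₀ X} {f g : X ⇒ C} →
                 IsCoalgebraHom H x c f → IsCoalgebraHom H x c g → f ≈ g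
    unfold-ext p r = trans (sym (unfold-unique p)) (unfold-unique r)

    private
      -- `structure` factors as `structure ♯ ∘ structure ∘ G.F₁ (η _)`. Homomorphism claims thereby
      -- reduce to equations between maps out of Ĝ(ĜZ), which carries an H-coalgebra, so terminality
      -- can prove them.
      hom-from-mult : ∀ {Z A} {v : Ĝ.F₀ Z ⇒ A} {a : G.F₀ A ⇒ A} {w : Ĝ.F₀ (Ĝ.F₀ Z) ⇒ A} →
                      v ∘ structure ♯ ≈ w →
                      w ∘ structure ∘ G.F₁ (η _) ≈ a ∘ G.F₁ v →
                      IsAlgebraHom G structure a v
      hom-from-mult {Z} {A} {v} {a} {w} p r = begin
        v ∘ structure                                     ≈⟨ ∘-resp-≈ʳ identityʳ ⟨
        v ∘ (structure ∘ id)                              ≈⟨ ∘-resp-≈ʳ (∘-resp-≈ʳ (trans (GL.F-∘ extend-unit) G.identity)) ⟨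
        v ∘ (structure ∘ (G.F₁ (structure ♯) ∘ G.F₁ (η _))) ≈⟨ ∘-resp-≈ʳ (swapˡ extend-hom) ⟨
        v ∘ (structure ♯ ∘ (structure ∘ G.F₁ (η _)))      ≈⟨ pullˡ p ⟩
        w ∘ structure ∘ G.F₁ (η _)                        ≈⟨ r ⟩
        a ∘ G.F₁ v                                        ∎

    mult-cohom : ∀ {Z} {z : Z ⇒ H.F₀ (Ĝ.F₀ Z)} →
                 IsCoalgebraHom H (lift (H.F₁ (η _) ∘ lift z)) (lift z) (structure ♯)
    mult-cohom = extend-lift-coalgebra lift-model id-cohom

    -- The extension of any solution is a coalgebra morphism from `lift z` to `c`, so it is the
    -- unfolding; composing with `η Z` recovers the solution.
    corecursion-unique : ∀ {Z} {a : G.F₀ C ⇒ C} {z : Z ⇒ H.F₀ (Ĝ.F₀ Z)} {u : Z ⇒ C} →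
                         IsInterpretation ρ a → c ∘ u ≈ H.F₁ (extend a u) ∘ z →
                         u ≈ unfold (lift z) ∘ η Z
    corecursion-unique interp p =
      trans (sym extend-unit) (∘-resp-≈ˡ (sym (unfold-unique (extend-lift interp p))))

    corecursion : ∀ {Z} {a : G.F₀ C ⇒ C} (z : Z ⇒ H.F₀ (Ĝ.F₀ Z)) → IsInterpretation ρ a →
                  ∃! _≈_ λ (u : Z ⇒ C) → c ∘ u ≈ H.F₁ (extend a u) ∘ z
    corecursion {Z} {a} z interp =
      v ∘ η Z , solves , λ p → sym (corecursion-unique interp p)
      where
      v = unfold (lift z)

      v-hom : IsAlgebraHom G structure a v
      -- Terminality identifies `v ∘ structure ♯` with `extend a v`: both are coalgebra morphisms
      -- from the lift of `H.F₁ (η _) ∘ lift z`.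
      v-hom = hom-from-mult
        (unfold-ext (HL.cohom-∘ unfold-hom mult-cohom) (extend-lift-coalgebra interp unfold-hom))
        (trans (swapˡ extend-hom) (∘-resp-≈ʳ (GL.F-∘ extend-unit)))

      solves : c ∘ (v ∘ η Z) ≈ H.F₁ (extend a (v ∘ η Z)) ∘ z
      solves = begin
        c ∘ (v ∘ η Z)                       ≈⟨ swapˡ unfold-hom ⟩
        H.F₁ v ∘ (lift z ∘ η Z)             ≈⟨ ∘-resp-≈ (H.F-resp-≈ (sym (extend-unique v-hom refl))) lift-unit ⟩
        H.F₁ (extend a (v ∘ η Z)) ∘ z       ∎

    interpretation : ∃! _≈_ (IsInterpretation ρ)
    interpretation = a , interp , unique
      where
      -- The monad algebra `α` is obtained first, by coinduction; `α-unit` and `α-mult` are its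
      -- Eilenberg-Moore laws. `a` is its restriction along the universal transformation from G to
      -- Ĝ, so that `α` is `a ♯`.
      ĉ = lift (H.F₁ (η C) ∘ c)
      α = unfold ĉ
      a = α ∘ structure ∘ G.F₁ (η C)

      α-unit : α ∘ η C ≈ id
      α-unit = unfold-ext (HL.cohom-∘ unfold-hom lift-unit) id-cohom

      α-mult : α ∘ structure ♯ ≈ α ∘ Ĝ.F₁ α
      -- `Ĝ.F₁ α` extends `η C ∘ α`, which is a coalgebra morphism because both factors are.
      α-mult = unfold-ext (HL.cohom-∘ unfold-hom mult-cohom)
        (HL.cohom-∘ unfold-hom (extend-lift-coalgebra lift-model (HL.cohom-∘ lift-unit unfold-hom)))

      α-hom : IsAlgebraHom G structure a α
      α-hom = hom-from-mult α-mult (begin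
        (α ∘ Ĝ.F₁ α) ∘ structure ∘ G.F₁ (η _)          ≈⟨ pullʳ (swapˡ extend-hom) ⟩
        α ∘ structure ∘ G.F₁ (Ĝ.F₁ α) ∘ G.F₁ (η _)     ≈⟨ ∘-resp-≈ʳ (∘-resp-≈ʳ (GL.F-square extend-unit)) ⟩
        α ∘ structure ∘ G.F₁ (η C) ∘ G.F₁ α            ≈⟨ ∘-resp-≈ʳ assoc ⟨
        α ∘ ((structure ∘ G.F₁ (η C)) ∘ G.F₁ α)        ≈⟨ assoc ⟨
        a ∘ G.F₁ α                                     ∎)

      interp : IsInterpretation ρ a
      interp = begin
        c ∘ (α ∘ structure ∘ G.F₁ (η C))
          ≈⟨ swapˡ unfold-hom ⟩
        H.F₁ α ∘ (ĉ ∘ structure ∘ G.F₁ (η C))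
          ≈⟨ ∘-resp-≈ʳ (trans (pullˡ lift-model) (pullʳ assoc)) ⟩
        H.F₁ α ∘ (H.F₁ (structure ♯) ∘ ρ₀ _ ∘ G.F₁ ⟨ ĉ , id ⟩ ∘ G.F₁ (η C))
          -- The multiplication law trades the flattening `structure ♯` for `Ĝ.F₁ α`, to which
          -- naturality of the rule then applies.
          ≈⟨ swapˡ (HL.F-square α-mult) ⟩
        H.F₁ α ∘ (H.F₁ (Ĝ.F₁ α) ∘ ρ₀ _ ∘ G.F₁ ⟨ ĉ , id ⟩ ∘ G.F₁ (η C))
          ≈⟨ ∘-resp-≈ʳ (swapˡ (ρ-commute α)) ⟨
        H.F₁ α ∘ (ρ₀ C ∘ G.F₁ (H×Id.F₁ α) ∘ G.F₁ ⟨ ĉ , id ⟩ ∘ G.F₁ (η C))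
          ≈⟨ ∘-resp-≈ (H.F-resp-≈ (sym (extend-unique α-hom α-unit)))
               (∘-resp-≈ʳ (trans (∘-resp-≈ʳ (sym G.homomorphism)) (GL.F-∘ pairing))) ⟩
        H.F₁ (a ♯) ∘ ρ₀ C ∘ G.F₁ ⟨ c , id ⟩ ∎
        where
        pairing : H×Id.F₁ α ∘ (⟨ ĉ , id ⟩ ∘ η C) ≈ ⟨ c , id ⟩
        pairing = begin
          H×Id.F₁ α ∘ (⟨ ĉ , id ⟩ ∘ η C)
            ≈⟨ ∘-resp-≈ʳ (trans ⟨⟩-∘ (⟨⟩-cong lift-unit identityˡ)) ⟩
          H×Id.F₁ α ∘ ⟨ H.F₁ (η C) ∘ c , η C ⟩
            ≈⟨ ×₁-⟨⟩ ⟩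
          ⟨ H.F₁ α ∘ (H.F₁ (η C) ∘ c) , α ∘ η C ⟩
            ≈⟨ ⟨⟩-cong (cancelˡ (trans (HL.F-∘ α-unit) H.identity)) α-unit ⟩
          ⟨ c , id ⟩ ∎

      -- `a′ ♯` extends `id`, a coalgebra morphism on `c`, so it is a coalgebra morphism from `ĉ`
      -- and must be the unfolding. An algebra is in turn recovered from its monad algebra.
      ♯-determined : ∀ {a′} → IsInterpretation ρ a′ → α ≈ a′ ♯
      ♯-determined interp′ = unfold-unique (extend-lift-coalgebra interp′ id-cohom)

      unique : ∀ {a′} → IsInterpretation ρ a′ → a ≈ a′
      unique {a′} interp′ = begin
        α ∘ structure ∘ G.F₁ (η C)          ≈⟨ ∘-resp-≈ˡ (♯-determined interp′) ⟩
        a′ ♯ ∘ structure ∘ G.F₁ (η C)       ≈⟨ swapˡ extend-hom ⟩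
        a′ ∘ G.F₁ (a′ ♯) ∘ G.F₁ (η C)       ≈⟨ ∘-resp-≈ʳ (trans (GL.F-∘ extend-unit) G.identity) ⟩
        a′ ∘ id                             ≈⟨ identityʳ ⟩
        a′                                  ∎

-- Free monads along a natural transformation of signatures.

module _
  {o h q : Level} {𝒜 : Category o h q}
  {S G : Endofunctor 𝒜} (freeS : FreeAlgebras S) (freeG : FreeAlgebras G)
  (ι : NaturalTransformation S G)
  where
  open Category 𝒜
  open Equiv
  open NaturalTransformation ι renaming (component to ι₀; commute to ι-commute)
  open CategoryLemmas 𝒜
  private
    module Sᶠ = FreeAlgebraLemmas 𝒜 freeS
    module Gᶠ = FreeAlgebraLemmas 𝒜 freeG
    module S = Endofunctor S
    module G = Endofunctor G
    module Ŝ = Endofunctor (FreeMonad.functor freeS)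
    module Ĝ = Endofunctor (FreeMonad.functor freeG)

  module Restriction where
    restrict-hom : ∀ {A B} {a : G.F₀ A ⇒ A} {b : G.F₀ B ⇒ B} {f : A ⇒ B} →
                   IsAlgebraHom G a b f → IsAlgebraHom S (a ∘ ι₀ A) (b ∘ ι₀ B) f
    restrict-hom {f = f} p = trans (swapˡ p) (trans (∘-resp-≈ʳ (sym (ι-commute f))) (sym assoc))

    -- The monad morphism from Ŝ to Ĝ induced by `ι`.
    translate : ∀ X → Ŝ.F₀ X ⇒ Ĝ.F₀ X
    translate X = Sᶠ.extend (Gᶠ.structure ∘ ι₀ _) (FreeMonad.η freeG X)

    -- Both sides are S-homomorphisms into the restricted algebra with the same values on
    -- generators.
    extend-translate : ∀ {X A} {a : G.F₀ A ⇒ A} {f : X ⇒ A} →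
                       Gᶠ.extend a f ∘ translate X ≈ Sᶠ.extend (a ∘ ι₀ A) f
    extend-translate = Sᶠ.extend-fusion (restrict-hom Gᶠ.extend-hom) Gᶠ.extend-unit

    translate-commute : ∀ {X Y} (f : X ⇒ Y) → translate Y ∘ Ŝ.F₁ f ≈ Ĝ.F₁ f ∘ translate X
    translate-commute f = trans Sᶠ.extend-map (sym extend-translate)

-- Evaluating terms over one-step behaviours, with H adjoined as an operation.

module SandwichedLemmas
  {o h q : Level} {𝒜 : Category o h q}
  (products : BinaryProducts 𝒜) (coproducts : BinaryCoproducts 𝒜)
  {H : Endofunctor 𝒜} (terminal : TerminalCoalgebra H)
  {K : Endofunctor 𝒜} (freeK : FreeAlgebras K)
  (V : Endofunctor 𝒜) (freeF : FreeAlgebras (coproductFunctor coproducts K V))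
  (freeG : FreeAlgebras (coproductFunctor coproducts (coproductFunctor coproducts K V) H))
  where
  open Category 𝒜
  open Equiv
  open HomReasoning
  open BinaryProducts products hiding (_×_)
  open BinaryCoproducts coproducts
  open TerminalCoalgebra terminal
  open CategoryLemmas 𝒜
  open ProductLemmas 𝒜 products
  open CoproductLemmas 𝒜 coproducts
  open GSOS products terminal freeK
  open Sandwiched products coproducts terminal freeK V freeF
  open FreeMonad freeK using () renaming (functor to K̂; _♯ to _♯ᴷ)
  open FreeMonad freeF using () renaming (functor to M; _♯ to _♯ᶠ)
  open FreeMonad freeG using (η) renaming (functor to N; _♯ to _♯ᴳ)
  private
    F = coproductFunctor coproducts K V
    G = coproductFunctor coproducts F H
    module H = Endofunctor H
    module K = Endofunctor K
    module V = Endofunctor V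
    module G = Endofunctor G
    module K̂ = Endofunctor K̂
    module M = Endofunctor M
    module N = Endofunctor N
    module H×Id = Endofunctor H×Id
    module HL = FunctorLemmas 𝒜 H
    module Kᶠ = FreeAlgebraLemmas 𝒜 freeK
    module Fᶠ = FreeAlgebraLemmas 𝒜 freeF
    module Gᶠ = FreeAlgebraLemmas 𝒜 freeG
    module GG = GSOS products terminal freeG

    ιᶠ : NaturalTransformation F G
    ιᶠ = record { component = λ X → i₁ ; commute = λ f → sym inject₁ }

    ιᴷ : NaturalTransformation K G
    ιᴷ = record
      { component = λ X → i₁ ∘ i₁
      ; commute = λ f → sym (trans (swapˡ inject₁) (trans (∘-resp-≈ʳ inject₁) (sym assoc)))
      }

    module Rᶠ = Restriction freeF freeG ιᶠ
    module Rᴷ = Restriction freeK freeG ιᴷ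

  -- An element of HQ, read both as a one-step behaviour and as a term with H as its outermost operation.
  behave : ∀ {Q A} → G.F₀ A ⇒ A → Q ⇒ A → H.F₀ Q ⇒ H×Id.F₀ A
  behave a m = ⟨ H.F₁ m , a ∘ i₂ ∘ H.F₁ m ⟩

  behave-cong : ∀ {Q A} {a : G.F₀ A ⇒ A} {m m′ : Q ⇒ A} → m ≈ m′ → behave a m ≈ behave a m′
  behave-cong p = ⟨⟩-cong (H.F-resp-≈ p) (∘-resp-≈ʳ (∘-resp-≈ʳ (H.F-resp-≈ p)))

  behave-map : ∀ {P Q A} {a : G.F₀ A ⇒ A} {m : Q ⇒ A} {g : P ⇒ Q} →
               behave a m ∘ H.F₁ g ≈ behave a (m ∘ g)
  behave-map = trans ⟨⟩-∘ (⟨⟩-cong (sym H.homomorphism)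
    (pullʳ (pullʳ (sym H.homomorphism))))

  behave-hom : ∀ {Q A B} {a : G.F₀ A ⇒ A} {b : G.F₀ B ⇒ B} {w : A ⇒ B} {m : Q ⇒ A} →
               IsAlgebraHom G a b w → H×Id.F₁ w ∘ behave a m ≈ behave b (w ∘ m)
  behave-hom p = trans ×₁-⟨⟩ (⟨⟩-cong (sym H.homomorphism)
    (trans (swapˡ p) (∘-resp-≈ʳ (trans (swapˡ inject₂) (∘-resp-≈ʳ (sym H.homomorphism))))))

  -- Once H is interpreted by `c⁻¹`, the two readings of an element of HQ are the behaviour and the
  -- value of a single element of C.
  behave-terminal : ∀ {Q} {a : G.F₀ C ⇒ C} {m : Q ⇒ C} → a ∘ i₂ ≈ c⁻¹ →
                    ⟨ c , id ⟩ ∘ (c⁻¹ ∘ H.F₁ m) ≈ behave a m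
  behave-terminal p = trans ⟨⟩-∘ (⟨⟩-cong (cancelˡ c∘c⁻¹≈id) (trans identityˡ (sym (pullˡ p))))

  module _ {S : Endofunctor 𝒜} (freeS : FreeAlgebras S) where
    private
      module S = Endofunctor S
      module Sᶠ = FreeAlgebraLemmas 𝒜 freeS
      module Ŝ = Endofunctor (FreeMonad.functor freeS)

    -- Terms with leaves in HQ are evaluated in an algebra on HA × A, and only the behaviour is
    -- kept. When `t` is a `ruleAlgebra`, this iterates the rule through all operations of the term.
    sandwich : ∀ {Q A} → S.F₀ (H×Id.F₀ A) ⇒ H×Id.F₀ A → G.F₀ A ⇒ A → Q ⇒ A → Ŝ.F₀ (H.F₀ Q) ⇒ H.F₀ A
    sandwich t a m = π₁ ∘ Sᶠ.extend t (behave a m)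

    sandwich-cong : ∀ {Q A} {t : S.F₀ (H×Id.F₀ A) ⇒ H×Id.F₀ A} {a : G.F₀ A ⇒ A} {m m′ : Q ⇒ A} →
                    m ≈ m′ → sandwich t a m ≈ sandwich t a m′
    sandwich-cong p = ∘-resp-≈ʳ (Sᶠ.extend-cong refl (behave-cong p))

    sandwich-map : ∀ {P Q A} {t : S.F₀ (H×Id.F₀ A) ⇒ H×Id.F₀ A} {a : G.F₀ A ⇒ A} {m : Q ⇒ A} {g : P ⇒ Q} →
                   sandwich t a m ∘ Ŝ.F₁ (H.F₁ g) ≈ sandwich t a (m ∘ g)
    sandwich-map = pullʳ (trans Sᶠ.extend-map (Sᶠ.extend-cong refl behave-map))

    sandwich-hom : ∀ {Q A B} {t : S.F₀ (H×Id.F₀ A) ⇒ H×Id.F₀ A} {t′ : S.F₀ (H×Id.F₀ B) ⇒ H×Id.F₀ B}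
                     {a : G.F₀ A ⇒ A} {b : G.F₀ B ⇒ B} {w : A ⇒ B} {m : Q ⇒ A} →
                   IsAlgebraHom S t t′ (H×Id.F₁ w) → IsAlgebraHom G a b w →
                   H.F₁ w ∘ sandwich t a m ≈ sandwich t′ b (w ∘ m)
    sandwich-hom p r = trans (sym (swapˡ project₁)) (∘-resp-≈ʳ (Sᶠ.extend-fusion p (behave-hom r)))

    -- As `⟨ c , id ⟩` is a homomorphism and the leaves lie in its image, the whole evaluation can
    -- be carried out in C, with `c` applied once at the end.
    sandwich-terminal : ∀ {Q} {t : S.F₀ (H×Id.F₀ C) ⇒ H×Id.F₀ C} {a : G.F₀ C ⇒ C} {f : S.F₀ C ⇒ C} {m : Q ⇒ C} →
                        IsAlgebraHom S f t ⟨ c , id ⟩ → a ∘ i₂ ≈ c⁻¹ →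
                        sandwich t a m ≈ c ∘ Sᶠ.extend f (c⁻¹ ∘ H.F₁ m)
    sandwich-terminal p r =
      trans (∘-resp-≈ʳ (sym (Sᶠ.extend-fusion p (behave-terminal r)))) (pullˡ project₁)

  -- The GSOS rule for K + V + H combining `ℓ` and `e`.

  module _ (ℓ : AbstractGSOSRule) (e : SandwichedRPS) where
    open NaturalTransformation ℓ renaming (component to ℓ₀; commute to ℓ-commute)
    open NaturalTransformation e renaming (component to e₀; commute to e-commute)
    private
      module ℓᴸ = GSOSLemmas products terminal freeK ℓ

    private
      ruleⱽ : ∀ X → V.F₀ (H×Id.F₀ X) ⇒ H.F₀ (N.F₀ X)
      ruleⱽ X = sandwich freeK (ℓᴸ.ruleAlgebra (Gᶠ.structure ∘ i₁ ∘ i₁)) Gᶠ.structure (Rᶠ.translate X) ∘ e₀ X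

      -- An H-term steps to its own arguments, as variables. This forces the H-part of any
      -- interpretation to be a right inverse of `c`, hence `c⁻¹`.
      rule₀ : ∀ X → G.F₀ (H×Id.F₀ X) ⇒ H.F₀ (N.F₀ X)
      rule₀ X = [ [ H.F₁ (Rᴷ.translate X) ∘ ℓ₀ X , ruleⱽ X ] , H.F₁ (η X ∘ π₂) ]

      ruleᴷ-commute : ∀ {X Y} (f : X ⇒ Y) →
                      (H.F₁ (Rᴷ.translate Y) ∘ ℓ₀ Y) ∘ K.F₁ (H×Id.F₁ f) ≈
                      H.F₁ (N.F₁ f) ∘ (H.F₁ (Rᴷ.translate X) ∘ ℓ₀ X)
      ruleᴷ-commute f = trans (pullʳ (ℓ-commute f)) (swapˡ (HL.F-square (Rᴷ.translate-commute f)))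

      ruleⱽ-commute : ∀ {X Y} (f : X ⇒ Y) →
                      ruleⱽ Y ∘ V.F₁ (H×Id.F₁ f) ≈ H.F₁ (N.F₁ f) ∘ ruleⱽ X
      ruleⱽ-commute {X} {Y} f = begin
        ruleⱽ Y ∘ V.F₁ (H×Id.F₁ f)
          ≈⟨ pullʳ (e-commute f) ⟩
        sandwich freeK _ Gᶠ.structure (Rᶠ.translate Y) ∘ (K̂.F₁ (H.F₁ (M.F₁ f)) ∘ e₀ X)
          ≈⟨ pullˡ (trans (sandwich-map freeK) (sandwich-cong freeK (Rᶠ.translate-commute f))) ⟩
        sandwich freeK _ Gᶠ.structure (N.F₁ f ∘ Rᶠ.translate X) ∘ e₀ X
          ≈⟨ pullˡ (sandwich-hom freeK (ℓᴸ.ruleAlgebra-hom (Rᴷ.restrict-hom Gᶠ.extend-hom)) Gᶠ.extend-hom) ⟨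
        H.F₁ (N.F₁ f) ∘ ruleⱽ X ∎

    combinedRule : GG.AbstractGSOSRule
    combinedRule = record
      { component = rule₀
      ; commute = λ {X} {Y} f → begin
          rule₀ Y ∘ G.F₁ (H×Id.F₁ f)
            ≈⟨ trans []-+₁ ([]-cong []-+₁ refl) ⟩
          [ [ (H.F₁ (Rᴷ.translate Y) ∘ ℓ₀ Y) ∘ K.F₁ (H×Id.F₁ f) , ruleⱽ Y ∘ V.F₁ (H×Id.F₁ f) ]
          , H.F₁ (η Y ∘ π₂) ∘ H.F₁ (H×Id.F₁ f) ]
            ≈⟨ []-cong ([]-cong (ruleᴷ-commute f) (ruleⱽ-commute f))
                 (HL.F-square (trans (pullʳ project₂) (trans (sym assoc) (sym (pullˡ Gᶠ.extend-unit))))) ⟩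
          [ [ H.F₁ (N.F₁ f) ∘ (H.F₁ (Rᴷ.translate X) ∘ ℓ₀ X) , H.F₁ (N.F₁ f) ∘ ruleⱽ X ]
          , H.F₁ (N.F₁ f) ∘ H.F₁ (η X ∘ π₂) ]
            ≈⟨ trans ∘-[] ([]-cong ∘-[] refl) ⟨
          H.F₁ (N.F₁ f) ∘ rule₀ X ∎
      }

    private
      module ρᴸ = GSOSLemmas products terminal freeG combinedRule

      stepⱽ : ∀ {A} → G.F₀ A ⇒ A → V.F₀ (H×Id.F₀ A) ⇒ H.F₀ A
      stepⱽ {A} a = sandwich freeK (ℓᴸ.ruleAlgebra (a ∘ i₁ ∘ i₁)) a ((a ∘ i₁) ♯ᶠ) ∘ e₀ A

      ♯-rule : ∀ {A} (a : G.F₀ A ⇒ A) →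
               H.F₁ (a ♯ᴳ) ∘ rule₀ A ≈
               [ [ H.F₁ ((a ∘ i₁ ∘ i₁) ♯ᴷ) ∘ ℓ₀ A , stepⱽ a ] , H.F₁ π₂ ]
      ♯-rule {A} a = trans ∘-[] ([]-cong
        (trans ∘-[] ([]-cong
          (pullˡ (HL.F-∘ Rᴷ.extend-translate))
          (pullˡ (trans
            (sandwich-hom freeK (ℓᴸ.ruleAlgebra-hom (Rᴷ.restrict-hom Gᶠ.extend-hom)) Gᶠ.extend-hom)
            (sandwich-cong freeK Rᶠ.extend-translate)))))
        (HL.F-∘ (cancelˡ Gᶠ.extend-unit)))

      -- Splits the interpretation equation by summand: K gives the equation for `ℓ`, V the
      -- sandwiched equation, and H says that `c ∘ a ∘ i₂` is the identity.
      interpretation-rhs : (a : G.F₀ C ⇒ C) →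
        H.F₁ (a ♯ᴳ) ∘ rule₀ C ∘ G.F₁ ⟨ c , id ⟩ ≈
        [ [ H.F₁ ((a ∘ i₁ ∘ i₁) ♯ᴷ) ∘ ℓ₀ C ∘ K.F₁ ⟨ c , id ⟩ , stepⱽ a ∘ V.F₁ ⟨ c , id ⟩ ] , id ]
      interpretation-rhs a = trans (pullˡ (♯-rule a)) (trans []-+₁ ([]-cong
        (trans []-+₁ ([]-cong assoc refl))
        (trans (HL.F-∘ project₂) H.identity)))

      IsSolution-rhs : (K.F₀ C ⇒ C) → (V.F₀ C ⇒ C) → V.F₀ C ⇒ C
      IsSolution-rhs b s = b ♯ᴷ ∘ K̂.F₁ c⁻¹ ∘ K̂.F₁ (H.F₁ ([ b , s ] ♯ᶠ)) ∘ e₀ C ∘ V.F₁ ⟨ c , id ⟩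

      sandwich-extend : ∀ {S : Endofunctor 𝒜} (freeS : FreeAlgebras S) → let open FreeMonad freeS in
        ∀ {Q} {f : Endofunctor.F₀ S C ⇒ C} {m : Q ⇒ C} →
        f ♯ ∘ Endofunctor.F₁ functor c⁻¹ ∘ Endofunctor.F₁ functor (H.F₁ m) ≈
        FreeAlgebraLemmas.extend 𝒜 freeS f (c⁻¹ ∘ H.F₁ m)
      sandwich-extend freeS = trans (pullˡ ♯-map) extend-map
        where open FreeAlgebraLemmas 𝒜 freeS

      -- Since `b` interprets `ℓ`, `⟨ c , id ⟩` is a homomorphism from `b` to the rule algebra, so
      -- iterating `ℓ` collapses to `c` after `b ♯ᴷ`.
      stepⱽ-terminal : ∀ {a b s} → IsInterpretation ℓ b →
                       a ∘ i₁ ≈ [ b , s ] → a ∘ i₂ ≈ c⁻¹ →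
                       stepⱽ a ∘ V.F₁ ⟨ c , id ⟩ ≈ c ∘ IsSolution-rhs b s
      stepⱽ-terminal {a} {b} {s} interp p r = begin
        stepⱽ a ∘ V.F₁ ⟨ c , id ⟩
          ≈⟨ assoc ⟩
        sandwich freeK _ a ((a ∘ i₁) ♯ᶠ) ∘ (e₀ C ∘ V.F₁ ⟨ c , id ⟩)
          ≈⟨ ∘-resp-≈ˡ (sandwich-cong freeK (Fᶠ.extend-cong p refl)) ⟩
        sandwich freeK _ a ([ b , s ] ♯ᶠ) ∘ (e₀ C ∘ V.F₁ ⟨ c , id ⟩)
          ≈⟨ ∘-resp-≈ˡ (sandwich-terminal freeK
               (trans (ℓᴸ.model-hom interp) (∘-resp-≈ˡ (ℓᴸ.ruleAlgebra-cong (sym (trans (pullˡ p) inject₁))))) r) ⟩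
        (c ∘ Kᶠ.extend b (c⁻¹ ∘ H.F₁ ([ b , s ] ♯ᶠ))) ∘ (e₀ C ∘ V.F₁ ⟨ c , id ⟩)
          ≈⟨ pullʳ (∘-resp-≈ˡ (sym (sandwich-extend freeK))) ⟩
        c ∘ ((b ♯ᴷ ∘ K̂.F₁ c⁻¹ ∘ K̂.F₁ (H.F₁ ([ b , s ] ♯ᶠ))) ∘ (e₀ C ∘ V.F₁ ⟨ c , id ⟩))
          ≈⟨ ∘-resp-≈ʳ (trans assoc (∘-resp-≈ʳ assoc)) ⟩
        c ∘ IsSolution-rhs b s ∎

      c-cancel : ∀ {X} {f g : X ⇒ C} → c ∘ f ≈ c ∘ g → f ≈ g
      c-cancel p = trans (sym (cancelˡ c⁻¹∘c≈id)) (trans (∘-resp-≈ʳ p) (cancelˡ c⁻¹∘c≈id))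

    -- Solutions of `e` as interpretations of the combined rule.

    module _ (b : K.F₀ C ⇒ C) (interp : IsInterpretation ℓ b) where

      solution⇒interpretation : ∀ {s} → IsSolution b e s →
                                GG.IsInterpretation combinedRule [ [ b , s ] , c⁻¹ ]
      solution⇒interpretation {s} sol = begin
        c ∘ a
          ≈⟨ trans ∘-[] ([]-cong ∘-[] refl) ⟩
        [ [ c ∘ b , c ∘ s ] , c ∘ c⁻¹ ]
          ≈⟨ []-cong ([]-cong
               (trans interp (∘-resp-≈ˡ (H.F-resp-≈ (Kᶠ.extend-cong (sym (trans (pullˡ inject₁) inject₁)) refl))))
               (trans (∘-resp-≈ʳ sol) (sym (stepⱽ-terminal interp inject₁ inject₂))))
             c∘c⁻¹≈id ⟩
        [ [ H.F₁ ((a ∘ i₁ ∘ i₁) ♯ᴷ) ∘ ℓ₀ C ∘ K.F₁ ⟨ c , id ⟩ , stepⱽ a ∘ V.F₁ ⟨ c , id ⟩ ] , id ]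
          ≈⟨ interpretation-rhs a ⟨
        H.F₁ (a ♯ᴳ) ∘ rule₀ C ∘ G.F₁ ⟨ c , id ⟩ ∎
        where a = [ [ b , s ] , c⁻¹ ]

      interpretation⇒solution : ∀ {a} → GG.IsInterpretation combinedRule a → IsSolution b e (a ∘ i₁ ∘ i₂)
      interpretation⇒solution {a} p = c-cancel
        (trans atV (stepⱽ-terminal interp ([]-ext (trans assoc (trans aᴷ≈b (sym inject₁))) (trans assoc (sym inject₂))) aᴴ≈c⁻¹))
        where
        split = trans p (interpretation-rhs a)

        aᴷ-interp : IsInterpretation ℓ (a ∘ i₁ ∘ i₁)
        aᴷ-interp = trans (pullˡ split) (trans (pullˡ inject₁) inject₁)

        atV : c ∘ (a ∘ i₁ ∘ i₂) ≈ stepⱽ a ∘ V.F₁ ⟨ c , id ⟩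
        atV = trans (pullˡ split) (trans (pullˡ inject₁) inject₂)

        aᴴ≈c⁻¹ : a ∘ i₂ ≈ c⁻¹
        aᴴ≈c⁻¹ = c-cancel (trans (pullˡ split) (trans inject₂ (sym c∘c⁻¹≈id)))

        -- The given `b` is recovered only through uniqueness of interpretations of `ℓ`.
        aᴷ≈b : a ∘ i₁ ∘ i₁ ≈ b
        aᴷ≈b = let (_ , _ , unique) = ℓᴸ.interpretation in
          trans (sym (unique aᴷ-interp)) (unique interp)

      solution : ∃! _≈_ (IsSolution b e)
      solution = let (a , a-interp , unique) = ρᴸ.interpretation in
        a ∘ i₁ ∘ i₂ , interpretation⇒solution a-interp ,
        λ sol → trans (∘-resp-≈ˡ (unique (solution⇒interpretation sol))) (trans (pullˡ inject₁) inject₂)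

      -- Complete iterativity of the algebra for MHM.

      module _ (s : V.F₀ C ⇒ C) (sol : IsSolution b e s) where
        private
          f = [ b , s ]
          a = [ f , c⁻¹ ]
          a-interp = solution⇒interpretation sol

        -- Brings the algebra into the form of the right-hand side of `sandwich-terminal`, with
        -- leaves `c⁻¹ ∘ H.F₁ m`.
        MHM-algebra-map : ∀ {X} {x : X ⇒ C} →
                          MHM-algebra b s ∘ Endofunctor.F₁ MHM x ≈ Fᶠ.extend f (c⁻¹ ∘ H.F₁ (Fᶠ.extend f x))
        MHM-algebra-map {x = x} = begin
          (f ♯ᶠ ∘ M.F₁ c⁻¹ ∘ M.F₁ (H.F₁ (f ♯ᶠ))) ∘ M.F₁ (H.F₁ (M.F₁ x))
            ≈⟨ ∘-resp-≈ˡ (sandwich-extend freeF) ⟩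
          Fᶠ.extend f (c⁻¹ ∘ H.F₁ (f ♯ᶠ)) ∘ M.F₁ (H.F₁ (M.F₁ x))
            ≈⟨ Fᶠ.extend-map ⟩
          Fᶠ.extend f ((c⁻¹ ∘ H.F₁ (f ♯ᶠ)) ∘ H.F₁ (M.F₁ x))
            ≈⟨ Fᶠ.extend-cong refl (pullʳ (HL.F-∘ Fᶠ.♯-map)) ⟩
          Fᶠ.extend f (c⁻¹ ∘ H.F₁ (Fᶠ.extend f x)) ∎

        MHM-completelyIterative : IsCompletelyIterative coproducts MHM (MHM-algebra b s)
        MHM-completelyIterative {X} φ = u₀ ∘ i₁ , solves , λ sol′ →
            trans (∘-resp-≈ˡ (u₀-unique (from sol′))) inject₁
          where
          Z = X + C

          -- Parameters step as in `c`, and their successors are again parameters.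
          parameter : C ⇒ H.F₀ (N.F₀ Z)
          parameter = H.F₁ (η Z ∘ i₂) ∘ c

          -- The outer M-term is evaluated by iterating the combined rule. The H-layer supplies the
          -- step at its leaves, and the inner M-terms become N-terms over the variables of `Z`.
          guarded : M.F₀ (H.F₀ (M.F₀ X)) ⇒ H.F₀ (N.F₀ Z)
          guarded = sandwich freeF (ρᴸ.ruleAlgebra Gᶠ.structure ∘ i₁) Gᶠ.structure
                      (Gᶠ.extend Gᶠ.structure (η Z ∘ i₁) ∘ Rᶠ.translate X)

          z : Z ⇒ H.F₀ (N.F₀ Z)
          z = [ [ guarded , parameter ] ∘ φ , parameter ]

          rhs : X ⇒ C → X ⇒ C
          rhs x = [ MHM-algebra b s , id ] ∘ (Endofunctor.F₁ MHM x +₁ id) ∘ φ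

          parameter-eval : ∀ {u : Z ⇒ C} → H.F₁ (Gᶠ.extend a u) ∘ parameter ≈ H.F₁ (u ∘ i₂) ∘ c
          parameter-eval = pullˡ (HL.F-∘ (pullˡ Gᶠ.extend-unit))

          guarded-eval : ∀ {u : Z ⇒ C} →
            H.F₁ (Gᶠ.extend a u) ∘ guarded ≈ c ∘ MHM-algebra b s ∘ Endofunctor.F₁ MHM (u ∘ i₁)
          guarded-eval {u} = begin
            H.F₁ (Gᶠ.extend a u) ∘ guarded
              ≈⟨ sandwich-hom freeF (Rᶠ.restrict-hom (ρᴸ.ruleAlgebra-hom Gᶠ.extend-hom)) Gᶠ.extend-hom ⟩
            sandwich freeF (ρᴸ.ruleAlgebra a ∘ i₁) a
              (Gᶠ.extend a u ∘ Gᶠ.extend Gᶠ.structure (η Z ∘ i₁) ∘ Rᶠ.translate X)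
              ≈⟨ sandwich-cong freeF (begin
                   Gᶠ.extend a u ∘ Gᶠ.extend Gᶠ.structure (η Z ∘ i₁) ∘ Rᶠ.translate X
                     ≈⟨ pullˡ Gᶠ.extend-map ⟩
                   Gᶠ.extend a (u ∘ i₁) ∘ Rᶠ.translate X
                     ≈⟨ Rᶠ.extend-translate ⟩
                   Fᶠ.extend (a ∘ i₁) (u ∘ i₁)
                     ≈⟨ Fᶠ.extend-cong inject₁ refl ⟩
                   Fᶠ.extend f (u ∘ i₁) ∎) ⟩
            sandwich freeF (ρᴸ.ruleAlgebra a ∘ i₁) a (Fᶠ.extend f (u ∘ i₁))
              ≈⟨ sandwich-terminal freeF
                   -- The solution property of `s` enters here: it makes `a` an interpretation,
                   -- hence `⟨ c , id ⟩` a homomorphism on the F-part.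
                   (trans (∘-resp-≈ʳ (sym inject₁)) (Rᶠ.restrict-hom (ρᴸ.model-hom a-interp))) inject₂ ⟩
            c ∘ Fᶠ.extend f (c⁻¹ ∘ H.F₁ (Fᶠ.extend f (u ∘ i₁)))
              ≈⟨ ∘-resp-≈ʳ MHM-algebra-map ⟨
            c ∘ MHM-algebra b s ∘ Endofunctor.F₁ MHM (u ∘ i₁) ∎

          -- For `u` fixing the parameters, the corecursive equation for `z` is the equation for `φ`
          -- under `c`, which can be cancelled.
          z-eval : ∀ {u : Z ⇒ C} → u ∘ i₂ ≈ id →
                   H.F₁ (Gᶠ.extend a u) ∘ z ≈ c ∘ [ rhs (u ∘ i₁) , id ]
          z-eval {u} p = begin
            H.F₁ (Gᶠ.extend a u) ∘ z
              ≈⟨ trans ∘-[] ([]-cong (pullˡ ∘-[]) refl) ⟩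
            [ [ H.F₁ (Gᶠ.extend a u) ∘ guarded , H.F₁ (Gᶠ.extend a u) ∘ parameter ] ∘ φ
            , H.F₁ (Gᶠ.extend a u) ∘ parameter ]
              ≈⟨ []-cong (∘-resp-≈ˡ ([]-cong guarded-eval parameter≈c)) parameter≈c ⟩
            [ [ c ∘ MHM-algebra b s ∘ Endofunctor.F₁ MHM (u ∘ i₁) , c ∘ id ∘ id ] ∘ φ , c ∘ id ∘ id ]
              ≈⟨ []-cong (∘-resp-≈ˡ (trans (∘-resp-≈ʳ []-+₁) ∘-[])) (∘-resp-≈ʳ (sym identityˡ)) ⟨
            [ (c ∘ [ MHM-algebra b s , id ] ∘ (Endofunctor.F₁ MHM (u ∘ i₁) +₁ id)) ∘ φ , c ∘ id ]
              ≈⟨ []-cong (trans assoc (∘-resp-≈ʳ assoc)) refl ⟩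
            [ c ∘ rhs (u ∘ i₁) , c ∘ id ]
              ≈⟨ ∘-[] ⟨
            c ∘ [ rhs (u ∘ i₁) , id ] ∎
            where
            parameter≈c : H.F₁ (Gᶠ.extend a u) ∘ parameter ≈ c ∘ id ∘ id
            parameter≈c = trans parameter-eval (trans (∘-resp-≈ˡ (HL.F-id p))
              (trans identityˡ (sym (trans (∘-resp-≈ʳ identityˡ) identityʳ))))

          u₀ = proj₁ (ρᴸ.corecursion z a-interp)
          u₀-eq = proj₁ (proj₂ (ρᴸ.corecursion z a-interp))
          u₀-unique : ∀ {u} → c ∘ u ≈ H.F₁ (Gᶠ.extend a u) ∘ z → u₀ ≈ u
          u₀-unique = proj₂ (proj₂ (ρᴸ.corecursion z a-interp))

          -- Restricted to parameters, `u₀` is a coalgebra endomorphism of the terminal coalgebra.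
          u₀-parameter : u₀ ∘ i₂ ≈ id
          u₀-parameter = ρᴸ.unfold-ext
            (trans (pullˡ u₀-eq) (trans (pullʳ inject₂) parameter-eval))
            (trans identityʳ (sym (trans (∘-resp-≈ˡ H.identity) identityˡ)))

          solves : u₀ ∘ i₁ ≈ rhs (u₀ ∘ i₁)
          solves = trans (∘-resp-≈ˡ (c-cancel (trans u₀-eq (z-eval u₀-parameter)))) inject₁

          rhs-cong : ∀ {x y} → x ≈ y → rhs x ≈ rhs y
          rhs-cong p = ∘-resp-≈ʳ (∘-resp-≈ˡ
            ([]-cong (∘-resp-≈ʳ (Endofunctor.F-resp-≈ MHM p)) refl))

          -- Conversely, a solution of `φ` extended by `id` on parameters solves `z`, so uniqueness
          -- carries over.
          from : ∀ {x} → x ≈ rhs x → c ∘ [ x , id ] ≈ H.F₁ (Gᶠ.extend a [ x , id ]) ∘ z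
          from p = sym (trans (z-eval inject₂)
            (∘-resp-≈ʳ ([]-cong (trans (rhs-cong inject₁) (sym p)) refl)))

mainTheorem12 :
    {o h q : Level} (𝒜 : Category o h q)
    (products : BinaryProducts 𝒜) (coproducts : BinaryCoproducts 𝒜)
    (H : Endofunctor 𝒜) (terminal : TerminalCoalgebra H)
    (K V : Endofunctor 𝒜) →
    let _+F_ = coproductFunctor coproducts
        F = K +F V
    in
    (freeK : FreeAlgebras K) (freeF : FreeAlgebras F) (freeF+H : FreeAlgebras (F +F H)) →
    let open Category 𝒜
        open TerminalCoalgebra terminal using (C)
        open GSOS products terminal freeK
        open Sandwiched products coproducts terminal freeK V freeF
    in
    (ℓ : AbstractGSOSRule) (b : Endofunctor.F₀ K C ⇒ C) → IsInterpretation ℓ b →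
    (e : SandwichedRPS) →
    ∃! _≈_ (IsSolution b e) ×
    (∀ s → IsSolution b e s → IsCompletelyIterative coproducts MHM (MHM-algebra b s))
mainTheorem12 𝒜 products coproducts H terminal K V freeK freeF freeF+H ℓ b interp e =
    solution ℓ e b interp , MHM-completelyIterative ℓ e b interp
  where open SandwichedLemmas products coproducts terminal freeK V freeF freeF+H
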